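{- For every integer $m$ with $3\leq m\leq 6$ we have $d_m\geq \frac{1}{m+2}$, and for every integer $m\geq 7$ we have $d_m\geq\frac18$.
   Context: For a positive integer $m$, a subset $A$ of an abelian group is $m$-sum-free if there is no triple $(x,y,z)\in A^3$ with $x+y=mz$. For a prime $p$, $d_m(\mathbb{Z}/p\mathbb{Z})=\max\{|A|/p : A\subseteq \mathbb{Z}/p\mathbb{Z}\ \text{is } m\text{ -sum-free}\}$. For $m\ge 3$ it is known (from prior work) that $d_m(\mathbb{Z}/p\mathbb{Z})$ converges as $p\to\infty$ through primes; $d_m$ denotes this limit. -}

module Defs where

open import Algebra.Bundles using (AbelianGroup)
open import Algebra.Structures using (IsAbelianGroup)
import Algebra.Definitions.RawMonoid as RawMonoidOps
open import Data.Bool.Base using (true; false)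
open import Data.Fin.Base using (Fin; toℕ)
open import Data.Fin.Properties using (toℕ-fromℕ<; toℕ-injective; toℕ<n; all?)
import Data.Fin.Properties as Fin
open import Data.Fin.Subset using (Subset; _∈_; ∣_∣; inside; outside)
  renaming (⊥ to ∅)
open import Data.Fin.Subset.Properties using (_∈?_; ∉⊥; ∣⊥∣≡0)
open import Data.Integer.Base as ℤ using (+_)
open import Data.List.Base using (List; []; _∷_; _++_; map; filter)
import Data.List.Extrema as Extrema
open import Data.List.Membership.Propositional using () renaming (_∈_ to _∈ˡ_)
open import Data.List.Membership.Propositional.Properties
  using (∈-map⁺; ∈-map⁻; ∈-++⁺ˡ; ∈-++⁺ʳ; ∈-filter⁺; ∈-filter⁻)
import Data.List.Relation.Unary.All as All
open import Data.List.Relation.Unary.Any using (here)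
open import Data.Nat.Base as ℕ using (ℕ; zero; suc; NonZero; _%_)
open import Data.Nat.DivMod
  using (_mod_; m%n<n; m%n%n≡m%n; %-distribˡ-+; n%n≡0; m<n⇒m%n≡m)
open import Data.Nat.Primality using (Prime; prime⇒nonZero)
import Data.Nat.Properties as ℕ
open import Data.Product.Base using (∃; _×_; _,_; proj₁; proj₂)
open import Data.Rational.Base using (ℚ; 0ℚ; 1ℚ; _<_; _≤_; _+_; _-_; _/_)
import Data.Rational.Properties as ℚ
open import Data.Sum.Base using (_⊎_; inj₁; inj₂)
open import Data.Vec.Base using ([]; _∷_)
open import Level using (Level; 0ℓ; _⊔_)
open import Relation.Binary.Bundles using (DecTotalOrder)
open import Relation.Binary.Definitions using (tri<; tri≈; tri>)
open import Relation.Binary.PropositionalEquality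
  using (_≡_; refl; sym; trans; cong; cong₂; subst; isEquivalence; module ≡-Reasoning)
open import Relation.Nullary using (Dec; ¬_; ¬?)
open import Relation.Nullary.Decidable using (_→-dec_)
open import Relation.Unary using (Pred)

private
  variable
    c ℓ p : Level

------------------------------------------------------------------------
-- m-sum-free sets in an abelian group

SumFree : (G : AbelianGroup c ℓ) → ℕ → Pred (AbelianGroup.Carrier G) p → Set (c ⊔ ℓ ⊔ p)
SumFree G m A = ∀ x y z → A x → A y → A z → ¬ (x ∙ y ≈ m · z)
  where
  open AbelianGroup G using (_∙_; _≈_; rawMonoid)
  open RawMonoidOps rawMonoid using () renaming (_×_ to _·_)

------------------------------------------------------------------------
-- The group ℤ/nℤ, on residues 0, …, n - 1

module _ (n : ℕ) .{{_ : NonZero n}} where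

  infixl 6 _+ₙ_
  _+ₙ_ : Fin n → Fin n → Fin n
  x +ₙ y = (toℕ x ℕ.+ toℕ y) mod n

  0ₙ : Fin n
  0ₙ = 0 mod n

  -ₙ_ : Fin n → Fin n
  -ₙ x = (n ℕ.∸ toℕ x) mod n

  toℕ-mod : ∀ k → toℕ (k mod n) ≡ k % n
  toℕ-mod k = toℕ-fromℕ< (m%n<n k n)

  private
    %-+ˡ : ∀ a b → (a % n ℕ.+ b) % n ≡ (a ℕ.+ b) % n
    %-+ˡ a b = begin
      (a % n ℕ.+ b) % n           ≡⟨ %-distribˡ-+ (a % n) b n ⟩
      (a % n % n ℕ.+ b % n) % n   ≡⟨ cong (λ t → (t ℕ.+ b % n) % n) (m%n%n≡m%n a n) ⟩
      (a % n ℕ.+ b % n) % n       ≡⟨ %-distribˡ-+ a b n ⟨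
      (a ℕ.+ b) % n               ∎
      where open ≡-Reasoning

    %-+ʳ : ∀ a b → (a ℕ.+ b % n) % n ≡ (a ℕ.+ b) % n
    %-+ʳ a b rewrite ℕ.+-comm a (b % n) | ℕ.+-comm a b = %-+ˡ b a

    +ₙ-comm : ∀ x y → x +ₙ y ≡ y +ₙ x
    +ₙ-comm x y = cong (_mod n) (ℕ.+-comm (toℕ x) (toℕ y))

    +ₙ-assoc : ∀ x y z → (x +ₙ y) +ₙ z ≡ x +ₙ (y +ₙ z)
    +ₙ-assoc x y z = toℕ-injective (begin
      toℕ ((x +ₙ y) +ₙ z)             ≡⟨ toℕ-mod _ ⟩
      (toℕ (x +ₙ y) ℕ.+ c′) % n       ≡⟨ cong (λ t → (t ℕ.+ c′) % n) (toℕ-mod _) ⟩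
      ((a ℕ.+ b) % n ℕ.+ c′) % n      ≡⟨ %-+ˡ (a ℕ.+ b) c′ ⟩
      ((a ℕ.+ b) ℕ.+ c′) % n          ≡⟨ cong (_% n) (ℕ.+-assoc a b c′) ⟩
      (a ℕ.+ (b ℕ.+ c′)) % n          ≡⟨ %-+ʳ a (b ℕ.+ c′) ⟨
      (a ℕ.+ (b ℕ.+ c′) % n) % n      ≡⟨ cong (λ t → (a ℕ.+ t) % n) (toℕ-mod _) ⟨
      (a ℕ.+ toℕ (y +ₙ z)) % n        ≡⟨ toℕ-mod _ ⟨
      toℕ (x +ₙ (y +ₙ z))             ∎)
      where
      open ≡-Reasoning
      a = toℕ x
      b = toℕ y
      c′ = toℕ z

    +ₙ-identityˡ : ∀ x → 0ₙ +ₙ x ≡ x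
    +ₙ-identityˡ x = toℕ-injective (begin
      toℕ (0ₙ +ₙ x)               ≡⟨ toℕ-mod _ ⟩
      (toℕ 0ₙ ℕ.+ toℕ x) % n      ≡⟨ cong (λ t → (t ℕ.+ toℕ x) % n) (toℕ-mod 0) ⟩
      (0 % n ℕ.+ toℕ x) % n       ≡⟨ %-+ˡ 0 (toℕ x) ⟩
      toℕ x % n                   ≡⟨ m<n⇒m%n≡m (toℕ<n x) ⟩
      toℕ x                       ∎)
      where open ≡-Reasoning

    +ₙ-inverseˡ : ∀ x → (-ₙ x) +ₙ x ≡ 0ₙ
    +ₙ-inverseˡ x = toℕ-injective (begin
      toℕ ((-ₙ x) +ₙ x)                     ≡⟨ toℕ-mod _ ⟩
      (toℕ (-ₙ x) ℕ.+ toℕ x) % n            ≡⟨ cong (λ t → (t ℕ.+ toℕ x) % n) (toℕ-mod _) ⟩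
      ((n ℕ.∸ toℕ x) % n ℕ.+ toℕ x) % n     ≡⟨ %-+ˡ (n ℕ.∸ toℕ x) (toℕ x) ⟩
      ((n ℕ.∸ toℕ x) ℕ.+ toℕ x) % n         ≡⟨ cong (_% n) (ℕ.m∸n+n≡m (ℕ.<⇒≤ (toℕ<n x))) ⟩
      n % n                                 ≡⟨ n%n≡0 n ⟩
      0                                     ≡⟨ m<n⇒m%n≡m (ℕ.>-nonZero⁻¹ n) ⟨
      0 % n                                 ≡⟨ toℕ-mod 0 ⟨
      toℕ 0ₙ                                ∎)
      where open ≡-Reasoning

    isAbelianGroup : IsAbelianGroup _≡_ _+ₙ_ 0ₙ -ₙ_
    isAbelianGroup = record
      { isGroup = record
        { isMonoid = record
          { isSemigroup = record
            { isMagma = record { isEquivalence = isEquivalence ; ∙-cong = cong₂ _+ₙ_ }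
            ; assoc   = +ₙ-assoc
            }
          ; identity = +ₙ-identityˡ , λ x → trans (+ₙ-comm x 0ₙ) (+ₙ-identityˡ x)
          }
        ; inverse = +ₙ-inverseˡ , λ x → trans (+ₙ-comm x (-ₙ x)) (+ₙ-inverseˡ x)
        ; ⁻¹-cong = cong -ₙ_
        }
      ; comm = +ₙ-comm
      }

  ℤ/ : AbelianGroup 0ℓ 0ℓ
  ℤ/ = record { isAbelianGroup = isAbelianGroup }

------------------------------------------------------------------------
-- The maximal density of an m-sum-free subset of ℤ/nℤ

subsets : ∀ n → List (Subset n)
subsets zero    = [] ∷ []
subsets (suc n) = map (outside ∷_) (subsets n) ++ map (inside ∷_) (subsets n)

subsets-complete : ∀ {n} (A : Subset n) → A ∈ˡ subsets n
subsets-complete {zero}  []          = here refl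
subsets-complete {suc n} (false ∷ A) = ∈-++⁺ˡ (∈-map⁺ (outside ∷_) (subsets-complete A))
subsets-complete {suc n} (true  ∷ A) =
  ∈-++⁺ʳ (map (outside ∷_) (subsets n)) (∈-map⁺ (inside ∷_) (subsets-complete A))

module _ (m n : ℕ) .{{_ : NonZero n}} where

  SumFreeSubset : Subset n → Set
  SumFreeSubset A = SumFree (ℤ/ n) m (_∈ A)

  sumFreeSubset? : ∀ A → Dec (SumFreeSubset A)
  sumFreeSubset? A =
    all? λ x → all? λ y → all? λ z →
      (x ∈? A) →-dec ((y ∈? A) →-dec ((z ∈? A) →-dec ¬? (_ Fin.≟ _)))

  density : Subset n → ℚ
  density A = + ∣ A ∣ / n

  private
    open module Ext = Extrema (DecTotalOrder.totalOrder ℚ.≤-decTotalOrder) using (max)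

    densities : List ℚ
    densities = map density (filter sumFreeSubset? (subsets n))

  -- The default value 0 of the maximum is the density of the m-sum-free set ∅,
  -- so it does not affect the result (see d-attained and d-upperBound).
  d : ℚ
  d = max 0ℚ densities

  d-upperBound : ∀ A → SumFreeSubset A → density A ≤ d
  d-upperBound A A-free = All.lookup (Ext.xs≤max 0ℚ densities)
    (∈-map⁺ density (∈-filter⁺ sumFreeSubset? (subsets-complete A) A-free))

  private
    density-∅ : density ∅ ≡ 0ℚ
    density-∅ = trans (cong (λ k → + k / n) (∣⊥∣≡0 n)) (ℚ.0/n≡0 n)

  d-attained : ∃ λ A → SumFreeSubset A × d ≡ density A
  d-attained with Ext.argmax-sel (λ q → q) 0ℚ densities
  ... | inj₁ d≡0 = ∅ , (λ _ _ _ x∈∅ _ _ _ → ∉⊥ x∈∅) , trans d≡0 (sym density-∅)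
  ... | inj₂ d∈  with ∈-map⁻ density d∈
  ...   | A , A∈ , d≡ = A , proj₂ (∈-filter⁻ sumFreeSubset? {xs = subsets n} A∈) , d≡

------------------------------------------------------------------------
-- Real numbers, as two-sided Dedekind cuts: L q means q < x, U q means x < q

record ℝ : Set₁ where
  field
    L U         : Pred ℚ 0ℓ
    L-inhabited : ∃ L
    U-inhabited : ∃ U
    L-lower     : ∀ {q r} → q < r → L r → L q
    U-upper     : ∀ {q r} → q < r → U q → U r
    L-open      : ∀ {q} → L q → ∃ λ r → q < r × L r
    U-open      : ∀ {r} → U r → ∃ λ q → q < r × U q
    disjoint    : ∀ {q} → L q → ¬ U q
    located     : ∀ {q r} → q < r → L q ⊎ U r

open ℝ

fromℚ : ℚ → ℝ
fromℚ x = record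
  { L           = _< x
  ; U           = x <_
  ; L-inhabited = x - 1ℚ , subst (x - 1ℚ <_) (ℚ.+-identityʳ x) (ℚ.+-monoʳ-< x (ℚ.negative⁻¹ _))
  ; U-inhabited = x + 1ℚ , subst (_< x + 1ℚ) (ℚ.+-identityʳ x) (ℚ.+-monoʳ-< x (ℚ.positive⁻¹ _))
  ; L-lower     = ℚ.<-trans
  ; U-upper     = λ q<r x<q → ℚ.<-trans x<q q<r
  ; L-open      = λ q<x → let r , q<r , r<x = ℚ.<-dense q<x in r , q<r , r<x
  ; U-open      = λ x<r → let q , x<q , q<r = ℚ.<-dense x<r in q , q<r , x<q
  ; disjoint    = ℚ.<-asym
  ; located     = locate
  }
  where
  locate : ∀ {q r} → q < r → q < x ⊎ x < r
  locate {q} q<r with ℚ.<-cmp q x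
  ... | tri< q<x _ _    = inj₁ q<x
  ... | tri≈ _ refl _   = inj₂ q<r
  ... | tri> _ _ x<q    = inj₂ (ℚ.<-trans x<q q<r)

infix 4 _≤ᴿ_ _≥ᴿ_
_≤ᴿ_ _≥ᴿ_ : ℝ → ℝ → Set
x ≤ᴿ y = ∀ q → L x q → L y q
x ≥ᴿ y = y ≤ᴿ x

∣_-_∣<_ : ℚ → ℝ → ℚ → Set
∣ a - x ∣< ε = L x (a - ε) × U x (a + ε)

ConvergesAlongPrimes : (∀ n → .{{NonZero n}} → ℚ) → ℝ → Set
ConvergesAlongPrimes a x =
  ∀ ε → 0ℚ < ε → ∃ λ N → ∀ n (n-prime : Prime n) → N ℕ.≤ n →
    ∣ a n {{prime⇒nonZero n-prime}} - x ∣< ε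

-- The real d_m is the value of the limit, so it is given by this relation
-- rather than by a function of m, which would require a proof of convergence.
IsLimitDensity : ℕ → ℝ → Set
IsLimitDensity m dₘ = ConvergesAlongPrimes (λ n → d m n) dₘ

{-# OPTIONS --safe #-}

-- Write m = 2 + k and let n > m be prime, so that multiplication by k is onto
-- ℤ/nℤ.  Given h and a residue c = k s, let A consist of the x = s + i with
-- 0 ≤ i < h such that c + m i has residue at least 2h.  If x = s + i, y = s + j
-- and z = s + l lie in A and x + y = m z, then i + j = c + m l; but i + j has
-- residue less than 2h.  Hence A is m-sum-free.
-- For h = ⌊n/(m + 2)⌋ and c = 2h the residue condition holds for every i < h, so
-- |A| = h.  For h = ⌊n/4⌋ the average of |A| over all c is h (n - 2h)/n, which
-- is n/8 up to a bounded error.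

module Submission where

open import Defs
open import Algebra.Bundles using (AbelianGroup)
import Algebra.Properties.AbelianGroup
import Algebra.Properties.CommutativeMonoid.Mult
open import Algebra.Properties.CommutativeSemigroup using (interchange)
import Algebra.Properties.Semiring.Sum as Sum
open import Data.Fin.Base using (Fin; zero; suc; toℕ)
open import Data.Fin.Permutation using (Permutation′; permutation)
open import Data.Fin.Properties using (toℕ-injective)
open import Data.Fin.Subset using (Subset; ∣_∣; _∈_)
open import Data.Integer.Base as ℤ using (+_)
import Data.Integer.Properties as ℤ
open import Data.List.Base using ([]; _∷_)
open import Data.List.Relation.Unary.All using (_∷_)
open import Data.Nat.Base as ℕ
  using (ℕ; zero; suc; _+_; _*_; _∸_; _%_; _!; _≤_; _<_; _≥_; s≤s; z<s; NonZero; nonTrivial⇒≢1)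
open import Data.Nat.Coprimality using (Coprime; coprime-Bézout; prime⇒coprime)
open import Data.Nat.Divisibility using (_∣_; ∣-trans; ∣1⇒≡1; m∣m*n; ∣m+n∣m⇒∣n; m≤n⇒m!∣n!)
open import Data.Nat.DivMod
  using (_mod_; %-distribˡ-+; m%n%n≡m%n; m*n%n≡0; m<n⇒m%n≡m; m%n≤m; m%n<n; m≡m%n+[m/n]*n;
         m/n*n≤m; m/n≤m)
open import Data.Nat.GCD using (module Bézout)
open import Data.Nat.ListAction using (product)
open import Data.Nat.Primality using (Prime; prime⇒nonZero; prime⇒nonTrivial)
open import Data.Nat.Primality.Factorisation using (factorise)
open import Data.Nat.Properties
open import Data.Nat.Tactic.RingSolver using (solve-∀)
open import Data.Product.Base using (∃; _×_; _,_; proj₁; proj₂)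
open import Data.Rational.Base as ℚ using (ℚ; 0ℚ; mkℚ; *<*; _/_)
import Data.Rational.Properties as ℚ
import Data.Rational.Unnormalised.Base as ℚᵘ
import Data.Rational.Unnormalised.Properties as ℚᵘ
open import Data.Sum.Base using (inj₁; inj₂)
open import Data.Vec.Base using (tabulate)
open import Data.Vec.Properties using ([]=⇒lookup; lookup∘tabulate)
open import Function.Base using (_∘_)
open import Level using (0ℓ)
open import Relation.Binary.PropositionalEquality
  using (_≡_; refl; sym; trans; cong; cong₂; subst; subst₂; module ≡-Reasoning)
open import Relation.Nullary using (Dec; yes; no; does; contradiction)
open import Relation.Nullary.Decidable using (_×-dec_)
open import Relation.Unary using (Pred; Decidable)

open ℝ
open Algebra.Properties.AbelianGroup ℚ.+-0-abelianGroup using (//-rightDividesˡ; //-rightDividesʳ; ⁻¹-anti-homo-//)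
open Sum +-*-semiring using (sum; sum-cong-≗; sum-permute; sum-replicate-zero; ∑-comm; *-distribˡ-sum; *-distribʳ-sum)

private
  variable
    n : ℕ
    P Q : Set

-- Counting subsets of `Fin n` by sums of indicators.

𝟙 : Dec P → ℕ
𝟙 (yes _) = 1
𝟙 (no  _) = 0

𝟙-× : (P? : Dec P) (Q? : Dec Q) → 𝟙 (P? ×-dec Q?) ≡ 𝟙 P? * 𝟙 Q?
𝟙-× (yes _) (yes _) = refl
𝟙-× (yes _) (no  _) = refl
𝟙-× (no  _) _       = refl

𝟙-cong : (P? : Dec P) (Q? : Dec Q) → (P → Q) → (Q → P) → 𝟙 P? ≡ 𝟙 Q?
𝟙-cong (yes _) (yes _) _ _ = refl
𝟙-cong (no  _) (no  _) _ _ = refl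
𝟙-cong (yes p) (no ¬q) f _ = contradiction (f p) ¬q
𝟙-cong (no ¬p) (yes q) _ g = contradiction (g q) ¬p

⟪_⟫ : {P : Pred (Fin n) 0ℓ} → Decidable P → Subset n
⟪ P? ⟫ = tabulate (does ∘ P?)

∈⟪⟫⁻ : {P : Pred (Fin n) 0ℓ} (P? : Decidable P) {x : Fin n} → x ∈ ⟪ P? ⟫ → P x
∈⟪⟫⁻ P? {x} x∈ with P? x | trans (sym (lookup∘tabulate (does ∘ P?) x)) ([]=⇒lookup x∈)
... | yes p | _ = p

-- Cardinalities become sums, which can then be exchanged and reindexed.
∣⟪⟫∣ : {P : Pred (Fin n) 0ℓ} (P? : Decidable P) → ∣ ⟪ P? ⟫ ∣ ≡ sum (𝟙 ∘ P?)
∣⟪⟫∣ {zero}  P? = refl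
∣⟪⟫∣ {suc n} P? with P? zero
... | yes _ = cong suc (∣⟪⟫∣ (P? ∘ suc))
... | no  _ = ∣⟪⟫∣ (P? ∘ suc)

sum-𝟙-< : ∀ {n h} → h ≤ n → sum (λ (i : Fin n) → 𝟙 (toℕ i <? h)) ≡ h
sum-𝟙-< {n}     {zero}  _         = sum-replicate-zero n
sum-𝟙-< {suc n} {suc h} (s≤s h≤n) = cong suc (trans
  (sum-cong-≗ {n} λ i → 𝟙-cong (suc (toℕ i) <? suc h) (toℕ i <? h) ≤-pred s≤s)
  (sum-𝟙-< h≤n))

sum-𝟙-≥ : ∀ n h → sum (λ (i : Fin n) → 𝟙 (h ≤? toℕ i)) ≡ n ∸ h
sum-𝟙-≥ zero    zero    = refl
sum-𝟙-≥ zero    (suc h) = refl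
sum-𝟙-≥ (suc n) zero    = cong suc (sum-𝟙-≥ n zero)
sum-𝟙-≥ (suc n) (suc h) = trans
  (sum-cong-≗ {n} λ i → 𝟙-cong (suc h ≤? suc (toℕ i)) (h ≤? toℕ i) ≤-pred s≤s)
  (sum-𝟙-≥ n h)

-- The averaging principle, multiplied out to avoid division. The induction keeps the larger of the
-- first value and the value chosen in the tail.
sum-≤-*max : .{{_ : NonZero n}} (f : Fin n → ℕ) → ∃ λ i → sum f ≤ n * f i
sum-≤-*max {1}           f = zero , ≤-refl
sum-≤-*max {suc (suc n)} f with i , ih ← sum-≤-*max (f ∘ suc) with ≤-total (f zero) (f (suc i))
... | inj₁ f0≤fi = suc i , +-mono-≤ f0≤fi ih
... | inj₂ fi≤f0 = zero , +-monoʳ-≤ (f zero) (≤-trans ih (*-monoʳ-≤ (suc n) fi≤f0))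

-- Multiples and translations in ℤ/nℤ.

module _ (n : ℕ) .{{_ : NonZero n}} where

  open AbelianGroup (ℤ/ n)
    using (_∙_; ε; _⁻¹; _-_; assoc; comm; identityˡ; identityʳ; inverseʳ; commutativeMonoid; commutativeSemigroup)
  open Algebra.Properties.AbelianGroup (ℤ/ n) using (∙-cancelʳ)
    renaming (//-rightDividesˡ to x-y∙y≡x; //-rightDividesʳ to x∙y-y≡x)
  open Algebra.Properties.CommutativeMonoid.Mult commutativeMonoid
    using (×-distrib-+; ×-homo-+; ×-assocˡ) renaming (_×_ to infixr 7.5 _·_)

  toℕ-∙ : ∀ x y → toℕ (x ∙ y) ≡ (toℕ x + toℕ y) % n
  toℕ-∙ x y = toℕ-mod n (toℕ x + toℕ y)

  toℕ-· : ∀ k x → toℕ (k · x) ≡ (k * toℕ x) % n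
  toℕ-· zero    x = toℕ-mod n 0
  toℕ-· (suc k) x = begin
    toℕ (x ∙ k · x)                          ≡⟨ toℕ-∙ x (k · x) ⟩
    (toℕ x + toℕ (k · x)) % n                ≡⟨ %-distribˡ-+ (toℕ x) (toℕ (k · x)) n ⟩
    (toℕ x % n + toℕ (k · x) % n) % n        ≡⟨ cong (λ t → (toℕ x % n + t % n) % n) (toℕ-· k x) ⟩
    (toℕ x % n + (k * toℕ x) % n % n) % n    ≡⟨ cong (λ t → (toℕ x % n + t) % n) (m%n%n≡m%n (k * toℕ x) n) ⟩
    (toℕ x % n + (k * toℕ x) % n) % n        ≡⟨ %-distribˡ-+ (toℕ x) (k * toℕ x) n ⟨
    (toℕ x + k * toℕ x) % n                  ∎
    where open ≡-Reasoning

  toℕ-mod-∙-· : ∀ a k x → toℕ ((a mod n) ∙ k · x) ≡ (a + k * toℕ x) % n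
  toℕ-mod-∙-· a k x = begin
    toℕ ((a mod n) ∙ k · x)               ≡⟨ toℕ-∙ (a mod n) (k · x) ⟩
    (toℕ (a mod n) + toℕ (k · x)) % n     ≡⟨ cong₂ (λ s t → (s + t) % n) (toℕ-mod n a) (toℕ-· k x) ⟩
    (a % n + (k * toℕ x) % n) % n         ≡⟨ %-distribˡ-+ a (k * toℕ x) n ⟨
    (a + k * toℕ x) % n                   ∎
    where open ≡-Reasoning

  multiple·≡ε : ∀ q x → (q * n) · x ≡ ε
  multiple·≡ε q x = toℕ-injective (begin
    toℕ ((q * n) · x)    ≡⟨ toℕ-· (q * n) x ⟩
    (q * n * toℕ x) % n  ≡⟨ cong (_% n) (swap q n (toℕ x)) ⟩
    (q * toℕ x * n) % n  ≡⟨ m*n%n≡0 (q * toℕ x) n ⟩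
    0                    ≡⟨ m*n%n≡0 0 n ⟨
    0 % n                ≡⟨ toℕ-mod n 0 ⟨
    toℕ ε                ∎)
    where
    open ≡-Reasoning
    swap : ∀ a b c → a * b * c ≡ a * c * b
    swap = solve-∀

  -- A Bézout coefficient `y` inverts `k` modulo `n` up to sign. Over ℕ the identity has two forms;
  -- in the one with `y * k` congruent to -1, the sign is absorbed by taking a multiple of `c ⁻¹`.
  ·-surjective : ∀ {k} → Coprime n k → ∀ c → ∃ λ s → k · s ≡ c
  ·-surjective {k} n⊥k c with coprime-Bézout n⊥k
  ... | Bézout.-+ x y 1+xn≡yk = y · c , (begin
    k · y · c            ≡⟨ ×-assocˡ c k y ⟩
    (k * y) · c          ≡⟨ cong (_· c) (trans (*-comm k y) (sym 1+xn≡yk)) ⟩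
    c ∙ (x * n) · c      ≡⟨ cong (c ∙_) (multiple·≡ε x c) ⟩
    c ∙ ε                ≡⟨ identityʳ c ⟩
    c                    ∎)
    where open ≡-Reasoning
  ... | Bézout.+- x y 1+yk≡xn = y · (c ⁻¹) , (begin
    k · y · c ⁻¹                 ≡⟨ ×-assocˡ (c ⁻¹) k y ⟩
    (k * y) · c ⁻¹               ≡⟨ cong (_· c ⁻¹) (*-comm k y) ⟩
    (y * k) · c ⁻¹               ≡⟨ identityˡ _ ⟨
    ε ∙ (y * k) · c ⁻¹           ≡⟨ cong (_∙ (y * k) · c ⁻¹) (inverseʳ c) ⟨
    c ∙ c ⁻¹ ∙ (y * k) · c ⁻¹    ≡⟨ assoc c (c ⁻¹) _ ⟩
    c ∙ ((1 + y * k) · c ⁻¹)     ≡⟨ cong (λ t → c ∙ t · c ⁻¹) 1+yk≡xn ⟩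
    c ∙ (x * n) · c ⁻¹           ≡⟨ cong (c ∙_) (multiple·≡ε x (c ⁻¹)) ⟩
    c ∙ ε                        ≡⟨ identityʳ c ⟩
    c                            ∎)
    where open ≡-Reasoning

  translation : Fin n → Permutation′ n
  translation s = permutation (_∙ s) (_- s) (x-y∙y≡x s) (x∙y-y≡x s)

  sum-translate : ∀ (f : Fin n → ℕ) s → sum (λ x → f (x ∙ s)) ≡ sum f
  sum-translate f s = sym (sum-permute f (translation s))

  -- Slices and their sizes.

  module _ (m h : ℕ) where

    -- The condition is put on the offset `i = x - s`. The shift `s` enters only in
    -- `translatedSlice`, so the size depends on `c` alone and can be averaged over `c`.
    InSlice : Fin n → Fin n → Set
    InSlice c i = toℕ i < h × h + h ≤ toℕ (c ∙ m · i)

    inSlice? : ∀ c → Decidable (InSlice c)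
    inSlice? c i = (toℕ i <? h) ×-dec (h + h ≤? toℕ (c ∙ m · i))

    sliceSize : Fin n → ℕ
    sliceSize c = sum (𝟙 ∘ inSlice? c)

    translatedSlice : Fin n → Fin n → Subset n
    translatedSlice c s = ⟪ (λ x → inSlice? c (x - s)) ⟫

    ∣translatedSlice∣ : ∀ c s → ∣ translatedSlice c s ∣ ≡ sliceSize c
    ∣translatedSlice∣ c s = trans (∣⟪⟫∣ (λ x → inSlice? c (x - s)))
      (sum-translate (𝟙 ∘ inSlice? c) (s ⁻¹))

    -- Double counting of the pairs `(c , i)`: for fixed `i` the map `c ↦ c ∙ m · i` is a
    -- translation, so the number of suitable `c` is the same for all `i` and the double sum
    -- factors.
    sum-sliceSize : h ≤ n → sum sliceSize ≡ h * (n ∸ (h + h))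
    sum-sliceSize h≤n = begin
      sum (λ c → sum (λ i → 𝟙 (inSlice? c i)))          ≡⟨ ∑-comm (λ c i → 𝟙 (inSlice? c i)) ⟩
      sum (λ i → sum (λ c → 𝟙 (inSlice? c i)))          ≡⟨ sum-cong-≗ (λ i → sum-cong-≗ (𝟙-×-IJ i)) ⟩
      sum (λ i → sum (λ c → I i * J (c ∙ m · i)))       ≡⟨ sum-cong-≗ (λ i → *-distribˡ-sum (I i) (λ c → J (c ∙ m · i))) ⟨
      sum (λ i → I i * sum (λ c → J (c ∙ m · i)))       ≡⟨ sum-cong-≗ (λ i → cong (I i *_) (sum-translate J (m · i))) ⟩
      sum (λ i → I i * sum J)                           ≡⟨ *-distribʳ-sum (sum J) I ⟨
      sum I * sum J                                     ≡⟨ cong₂ _*_ (sum-𝟙-< h≤n) (sum-𝟙-≥ n (h + h)) ⟩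
      h * (n ∸ (h + h))                                 ∎
      where
      open ≡-Reasoning
      I J : Fin n → ℕ
      I i = 𝟙 (toℕ i <? h)
      J w = 𝟙 (h + h ≤? toℕ w)
      𝟙-×-IJ : ∀ i c → 𝟙 (inSlice? c i) ≡ I i * J (c ∙ m · i)
      𝟙-×-IJ i c = 𝟙-× (toℕ i <? h) (h + h ≤? toℕ (c ∙ m · i))

    -- For `i < h` the integer `h + h + m * i` stays below `n`, so it is its own residue and the
    -- lower bound `h + h` is automatic.
    sliceSize-full : .{{_ : NonZero m}} → h + h + m * h ≤ n → sliceSize ((h + h) mod n) ≡ h
    sliceSize-full 2h+mh≤n = trans
      (sum-cong-≗ λ i → 𝟙-cong (inSlice? c i) (toℕ i <? h) proj₁ λ i<h → i<h , above i i<h)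
      (sum-𝟙-< (m+n≤o⇒m≤o h (m+n≤o⇒m≤o (h + h) 2h+mh≤n)))
      where
      c = (h + h) mod n
      above : ∀ i → toℕ i < h → h + h ≤ toℕ (c ∙ m · i)
      above i i<h = begin
        h + h                      ≤⟨ m≤m+n (h + h) (m * toℕ i) ⟩
        h + h + m * toℕ i          ≡⟨ m<n⇒m%n≡m no-wrap ⟨
        (h + h + m * toℕ i) % n    ≡⟨ toℕ-mod-∙-· (h + h) m i ⟨
        toℕ (c ∙ m · i)            ∎
        where
        open ≤-Reasoning
        no-wrap : h + h + m * toℕ i < n
        no-wrap = <-≤-trans (+-monoʳ-< (h + h) (*-monoʳ-< m i<h)) 2h+mh≤n

  -- Translated slices are sum-free.

  module _ (k h : ℕ) where
    private m = 2 + k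

    translatedSlice-sumFree : ∀ {c} s → k · s ≡ c → SumFreeSubset m n (translatedSlice m h c s)
    translatedSlice-sumFree {c} s ks≡c x y z x∈ y∈ z∈ x+y≡mz = <⇒≱ i+j<2h 2h≤w
      where
      i = x - s
      j = y - s
      l = z - s
      in? = λ x → inSlice? m h c (x - s)

      i+j≡w : i ∙ j ≡ c ∙ m · l
      -- Adding `2 · s` turns the left side into `x ∙ y`. Since `m · s` is `k · s ∙ 2 · s`, that is
      -- `c ∙ 2 · s`, it turns the right side into `m · z`.
      i+j≡w = ∙-cancelʳ (2 · s) (i ∙ j) (c ∙ m · l) (begin
        i ∙ j ∙ 2 · s                  ≡⟨ cong (λ t → i ∙ j ∙ (s ∙ t)) (identityʳ s) ⟩
        i ∙ j ∙ (s ∙ s)                ≡⟨ interchange commutativeSemigroup i j s s ⟩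
        (i ∙ s) ∙ (j ∙ s)              ≡⟨ cong₂ _∙_ (x-y∙y≡x s x) (x-y∙y≡x s y) ⟩
        x ∙ y                          ≡⟨ x+y≡mz ⟩
        m · z                          ≡⟨ cong (m ·_) (x-y∙y≡x s z) ⟨
        m · (l ∙ s)                    ≡⟨ ×-distrib-+ l s m ⟩
        m · l ∙ m · s                  ≡⟨ cong (m · l ∙_) (trans (×-homo-+ s 2 k) (comm (2 · s) (k · s))) ⟩
        m · l ∙ (k · s ∙ 2 · s)        ≡⟨ cong (λ t → m · l ∙ (t ∙ 2 · s)) ks≡c ⟩
        m · l ∙ (c ∙ 2 · s)            ≡⟨ assoc (m · l) c (2 · s) ⟨
        m · l ∙ c ∙ 2 · s              ≡⟨ cong (_∙ 2 · s) (comm (m · l) c) ⟩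
        c ∙ m · l ∙ 2 · s              ∎)
        where open ≡-Reasoning

      2h≤w : h + h ≤ toℕ (i ∙ j)
      2h≤w = subst (λ w → h + h ≤ toℕ w) (sym i+j≡w) (proj₂ (∈⟪⟫⁻ in? z∈))

      -- Reduction modulo `n` never increases a number, so a possible wrap-around of `i ∙ j` does no
      -- harm.
      i+j<2h : toℕ (i ∙ j) < h + h
      i+j<2h = ≤-<-trans
        (≤-trans (≤-reflexive (toℕ-∙ i j)) (m%n≤m (toℕ i + toℕ j) n))
        (+-mono-< (proj₁ (∈⟪⟫⁻ in? x∈)) (proj₁ (∈⟪⟫⁻ in? y∈)))

-- Primes beyond every bound.

prime-beyond : ∀ N → ∃ λ p → Prime p × N < p
-- Euclid's argument: a prime factor `p ≤ N` of `1 + N !` would divide `N !` as well, hence 1. An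
-- empty factorisation would force `N !` to be 0.
prime-beyond N with factorise (1 + N !)
... | record { factors = [] ; isFactorisation = eq } =
  contradiction (sym (suc-injective eq)) (<⇒≢ (1≤n! N))
... | record { factors = p ∷ ps ; isFactorisation = eq ; factorsPrime = p-prime ∷ _ } with p ≤? N
...   | no  p≰N = p , p-prime , ≰⇒> p≰N
...   | yes p≤N = contradiction (∣1⇒≡1 (∣m+n∣m⇒∣n p∣N!+1 p∣N!)) nonTrivial⇒≢1
  where
  instance
    _ = prime⇒nonTrivial p-prime
    p≢0 = prime⇒nonZero p-prime
  n∣n! : ∀ n .{{_ : NonZero n}} → n ∣ n !
  n∣n! (suc n) = m∣m*n (n !)
  p∣N! : p ∣ N !
  p∣N! = ∣-trans (n∣n! p) (m≤n⇒m!∣n! p≤N)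
  p∣N!+1 : p ∣ N ! + 1
  p∣N!+1 = subst (p ∣_) (trans (sym eq) (+-comm 1 (N !))) (m∣m*n (product ps))

-- Rational estimates.

toℚᵘ-/ : ∀ i n .{{_ : NonZero n}} → ℚ.toℚᵘ (i / n) ℚᵘ.≃ i ℚᵘ./ n
toℚᵘ-/ i (suc n) = ℚ.toℚᵘ-fromℚᵘ (i ℚᵘ./ suc n)

1/n<ε : ∀ {ε} → 0ℚ ℚ.< ε → ∃ λ N → ∀ n .{{_ : NonZero n}} → N ≤ n → + 1 / n ℚ.< ε
-- The threshold is the denominator `suc b-1` plus one, so that `suc b-1 < n ≤ suc a * n`.
1/n<ε {mkℚ (+ suc a) b-1 _} _ = 2 + b-1 , λ where
  n@(suc _) b<n → ℚ.toℚᵘ-cancel-< (ℚᵘ.<-respˡ-≃ (ℚᵘ.≃-sym (toℚᵘ-/ (+ 1) n))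
    (ℚᵘ.*<* (ℤ.+<+ (subst (_< suc a * n) (sym (*-identityˡ (suc b-1)))
      (<-≤-trans b<n (m≤m+n n (a * n)))))))
1/n<ε {mkℚ (+ 0) _ _}      (*<* (ℤ.+<+ ()))
1/n<ε {mkℚ ℤ.-[1+ _ ] _ _} (*<* ())

1/K≤a/n+1/n : ∀ K a n .{{_ : NonZero K}} .{{_ : NonZero n}} → n ≤ K * suc a →
              + 1 / K ℚ.≤ + a / n ℚ.+ + 1 / n
1/K≤a/n+1/n K@(suc _) a n@(suc _) n≤K[1+a] = ℚ.toℚᵘ-cancel-≤ (begin
  ℚ.toℚᵘ (+ 1 / K)                              ≃⟨ toℚᵘ-/ (+ 1) K ⟩
  + 1 ℚᵘ./ K                                    ≤⟨ ℚᵘ.*≤* cross-multiplied ⟩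
  (+ a ℤ.* + n ℤ.+ + 1 ℤ.* + n) ℚᵘ./ (n * n)    ≡⟨⟩
  + a ℚᵘ./ n ℚᵘ.+ + 1 ℚᵘ./ n                    ≃⟨ ℚᵘ.+-cong (toℚᵘ-/ (+ a) n) (toℚᵘ-/ (+ 1) n) ⟨
  ℚ.toℚᵘ (+ a / n) ℚᵘ.+ ℚ.toℚᵘ (+ 1 / n)        ≃⟨ ℚ.toℚᵘ-homo-+ (+ a / n) (+ 1 / n) ⟨
  ℚ.toℚᵘ (+ a / n ℚ.+ + 1 / n)                  ∎)
  where
  open ℚᵘ.≤-Reasoning

  collect : ∀ n K a → n * (K * suc a) ≡ (a * n + 1 * n) * K
  collect = solve-∀

  -- The unnormalised sum has denominator `n * n`, so the hypothesis is multiplied by `n`.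
  cross-multiplied : + 1 ℤ.* + (n * n) ℤ.≤ (+ a ℤ.* + n ℤ.+ + 1 ℤ.* + n) ℤ.* + K
  cross-multiplied = subst₂ ℤ._≤_
    (ℤ.pos-* 1 (n * n))
    (trans (ℤ.pos-* (a * n + 1 * n) K) (cong (ℤ._* + K) (cong₂ ℤ._+_ (ℤ.pos-* a n) (ℤ.pos-* 1 n))))
    (ℤ.+≤+ (≤-trans (≤-reflexive (*-identityˡ (n * n)))
      (≤-trans (*-monoʳ-≤ n n≤K[1+a]) (≤-reflexive (collect n K a)))))

-- Passing lower bounds to the limit along primes.

p-[p-q]≡q : ∀ p q → p ℚ.- (p ℚ.- q) ≡ q
p-[p-q]≡q p q = trans (cong (p ℚ.+_) (⁻¹-anti-homo-// p q))
  (trans (ℚ.+-comm p (q ℚ.- p)) (//-rightDividesˡ p q))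

0<q-p : ∀ {p q} → p ℚ.< q → 0ℚ ℚ.< q ℚ.- p
0<q-p {p} {q} p<q = subst (ℚ._< q ℚ.- p) (ℚ.+-inverseʳ p) (ℚ.+-monoˡ-< (ℚ.- p) p<q)

p≤q+e∧e<p-r⇒r<q : ∀ {p q e r} → p ℚ.≤ q ℚ.+ e → e ℚ.< p ℚ.- r → r ℚ.< q
p≤q+e∧e<p-r⇒r<q {p} {q} {e} {r} p≤q+e e<p-r = begin-strict
  r                             ≡⟨ p-[p-q]≡q p r ⟨
  p ℚ.- (p ℚ.- r)               ≤⟨ ℚ.+-monoˡ-≤ (ℚ.- (p ℚ.- r)) p≤q+e ⟩
  q ℚ.+ e ℚ.- (p ℚ.- r)         <⟨ ℚ.+-monoˡ-< (ℚ.- (p ℚ.- r)) (ℚ.+-monoʳ-< q e<p-r) ⟩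
  q ℚ.+ (p ℚ.- r) ℚ.- (p ℚ.- r) ≡⟨ //-rightDividesʳ (p ℚ.- r) q ⟩
  q                             ∎
  where open ℚ.≤-Reasoning

p<q⇒r<q-[p-r] : ∀ {p q} r → p ℚ.< q → r ℚ.< q ℚ.- (p ℚ.- r)
p<q⇒r<q-[p-r] {p} {q} r p<q = subst (ℚ._< q ℚ.- (p ℚ.- r)) (p-[p-q]≡q p r)
  (ℚ.+-monoˡ-< (ℚ.- (p ℚ.- r)) p<q)

-- Given `q < t`, pick `r` strictly between. At a large prime `n` the error `1/n` is below `t - r`,
-- so `a n` exceeds `r`; as `a n` is within `r - q` of `x`, the rational `q` lies in the lower cut
-- of `x`.
convergesAlongPrimes-≥ : ∀ a x {t} N₀ → ConvergesAlongPrimes a x →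
  (∀ n (n-prime : Prime n) (let instance n≢0 = prime⇒nonZero n-prime) →
     N₀ < n → t ℚ.≤ a n ℚ.+ + 1 / n) →
  x ≥ᴿ fromℚ t
convergesAlongPrimes-≥ a x N₀ a→x t≤a+1/n q q<t =
  let r , q<r , r<t     = ℚ.<-dense q<t
      N₁ , close        = a→x (r ℚ.- q) (0<q-p q<r)
      N₂ , small        = 1/n<ε (0<q-p r<t)
      -- The sum of the three thresholds dominates each of them.
      n , n-prime , N<n = prime-beyond (N₀ + N₁ + N₂)
      instance n≢0      = prime⇒nonZero n-prime
      N₀+N₁<n           = m+n≤o⇒m≤o (suc (N₀ + N₁)) N<n
      N₀<n              = m+n≤o⇒m≤o (suc N₀) N₀+N₁<n
      N₁≤n              = m+n≤o⇒n≤o N₀ (<⇒≤ N₀+N₁<n)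
      N₂≤n              = m+n≤o⇒n≤o (N₀ + N₁) (<⇒≤ N<n)
      r<a               = p≤q+e∧e<p-r⇒r<q {q = a n} (t≤a+1/n n n-prime N₀<n) (small n N₂≤n)
  in L-lower x (p<q⇒r<q-[p-r] {q = a n} q r<a) (proj₁ (close n n-prime N₁≤n))

module _ (m K : ℕ) .{{_ : NonZero K}} where

  -- Sets of density at least 1/K - 1/n, which suffices in the limit.
  HasLargeSumFreeSubset : (n : ℕ) .{{_ : NonZero n}} → Set
  HasLargeSumFreeSubset n = ∃ λ A → SumFreeSubset m n A × n ≤ K * suc ∣ A ∣

  1/K≤d+1/n : ∀ n .{{_ : NonZero n}} → HasLargeSumFreeSubset n → + 1 / K ℚ.≤ d m n ℚ.+ + 1 / n
  1/K≤d+1/n n (A , A-free , n≤K[1+∣A∣]) = ℚ.≤-trans (1/K≤a/n+1/n K ∣ A ∣ n n≤K[1+∣A∣])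
    (ℚ.+-monoˡ-≤ (+ 1 / n) (d-upperBound m n A A-free))

  limit-≥ : (∀ n (n-prime : Prime n) → m < n → HasLargeSumFreeSubset n {{prime⇒nonZero n-prime}}) →
            ∀ x → IsLimitDensity m x → x ≥ᴿ fromℚ (+ 1 / K)
  limit-≥ large x d→x = convergesAlongPrimes-≥ (λ n → d m n) x m d→x λ n n-prime m<n →
    1/K≤d+1/n n {{prime⇒nonZero n-prime}} (large n n-prime m<n)

-- Large sum-free sets modulo a prime.

module _ (k : ℕ) .{{_ : NonZero k}} (n : ℕ) (n-prime : Prime n) (m<n : 2 + k < n) where

  private
    m = 2 + k
    instance _ = prime⇒nonZero n-prime

  -- As `0 < k < n` and `n` is prime, `k · s ≡ c` is solvable for every `c`, which leaves the choice
  -- of `c` free.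
  sliceSize-attained : ∀ h c → ∃ λ A → SumFreeSubset m n A × ∣ A ∣ ≡ sliceSize n m h c
  sliceSize-attained h c =
    let s , ks≡c = ·-surjective n (prime⇒coprime n-prime (<-trans (m<n+m k z<s) m<n)) c
    in translatedSlice n m h c s , translatedSlice-sumFree n k h s ks≡c , ∣translatedSlice∣ n m h c s

  large-1/[m+2] : HasLargeSumFreeSubset m (2 + m) n
  large-1/[m+2] =
    A , A-free , (begin
      n                              ≡⟨ m≡m%n+[m/n]*n n K ⟩
      n % K + h * K                  ≤⟨ +-monoˡ-≤ (h * K) (<⇒≤ (m%n<n n K)) ⟩
      suc h * K                      ≡⟨ *-comm (suc h) K ⟩
      K * suc h                      ≡⟨ cong (λ a → K * suc a) (trans ∣A∣≡ (sliceSize-full n m h 2h+mh≤n)) ⟨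
      K * suc ∣ A ∣                  ∎)
    where
    open ≤-Reasoning
    K = 2 + m
    h = n ℕ./ K
    attained = sliceSize-attained h ((h + h) mod n)
    A = proj₁ attained
    A-free = proj₁ (proj₂ attained)
    ∣A∣≡ = proj₂ (proj₂ attained)
    2h+mh≤n : h + h + m * h ≤ n
    2h+mh≤n = begin
      h + h + m * h    ≡⟨ +-assoc h h (m * h) ⟩
      K * h            ≡⟨ *-comm K h ⟩
      h * K            ≤⟨ m/n*n≤m n K ⟩
      n                ∎

  large-1/8 : HasLargeSumFreeSubset m 8 n
  large-1/8 =
    A , A-free , *-cancelˡ-≤ n (begin
      n * n                                    ≡⟨ cong (λ t → t * t) n≡r+h*4 ⟩
      (r + h * 4) * (r + h * 4)                ≡⟨ expand r h ⟩
      r * r + 8 * (h * (r + (h + h)))          ≡⟨ cong (λ w → r * r + 8 * (h * w)) n∸2h≡ ⟨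
      r * r + 8 * (h * (n ∸ (h + h)))          ≤⟨ +-mono-≤ (*-mono-≤ (m%n≤m n 4) r≤8) (*-monoʳ-≤ 8 average) ⟩
      n * 8 + 8 * (n * sliceSize n m h c)      ≡⟨ cong (λ a → n * 8 + 8 * (n * a)) ∣A∣≡ ⟨
      n * 8 + 8 * (n * ∣ A ∣)                  ≡⟨ collect n ∣ A ∣ ⟩
      n * (8 * suc ∣ A ∣)                      ∎)
    where
    open ≤-Reasoning
    -- The product `h * (n - 2h)` is largest near `n/4`, where it is about `n * n / 8`.
    h = n ℕ./ 4
    c = proj₁ (sum-≤-*max (sliceSize n m h))
    average : h * (n ∸ (h + h)) ≤ n * sliceSize n m h c
    average = subst (_≤ n * sliceSize n m h c) (sum-sliceSize n m h (m/n≤m n 4))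
      (proj₂ (sum-≤-*max (sliceSize n m h)))
    attained = sliceSize-attained h c
    A = proj₁ attained
    A-free = proj₁ (proj₂ attained)
    ∣A∣≡ = proj₂ (proj₂ attained)
    r = n % 4
    -- The bound is weakened to 8 so that `r * r ≤ n * 8`, which is the slack granted by
    -- `suc ∣ A ∣`.
    r≤8 : r ≤ 8
    r≤8 = ≤-trans (<⇒≤ (m%n<n n 4)) (m≤m+n 4 4)
    n≡r+h*4 : n ≡ r + h * 4
    n≡r+h*4 = m≡m%n+[m/n]*n n 4
    expand : ∀ r h → (r + h * 4) * (r + h * 4) ≡ r * r + 8 * (h * (r + (h + h)))
    expand = solve-∀
    collect : ∀ n a → n * 8 + 8 * (n * a) ≡ n * (8 * suc a)
    collect = solve-∀
    split : ∀ r h → r + h * 4 ≡ r + (h + h) + (h + h)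
    split = solve-∀
    n∸2h≡ : n ∸ (h + h) ≡ r + (h + h)
    n∸2h≡ = trans (cong (_∸ (h + h)) (trans n≡r+h*4 (split r h))) (m+n∸n≡m (r + (h + h)) (h + h))

theorem1p7 : (∀ (m : ℕ) → 3 ≤ m → m ≤ 6 →
    ∀ (dₘ : ℝ) → IsLimitDensity m dₘ → dₘ ≥ᴿ fromℚ (+ 1 / (2 + m)))
    × (∀ (m : ℕ) → m ≥ 7 →
    ∀ (dₘ : ℝ) → IsLimitDensity m dₘ → dₘ ≥ᴿ fromℚ (+ 1 / 8))
theorem1p7 =
  -- Matching on `3 ≤ m` exposes `k = m - 2` as a successor, hence nonzero, in both halves.
  (λ where m@(suc (suc k@(suc _))) (s≤s (s≤s (s≤s _))) _ → limit-≥ m (2 + m) (large-1/[m+2] k)) ,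
  (λ where m@(suc (suc k@(suc _))) (s≤s (s≤s (s≤s _))) → limit-≥ m 8 (large-1/8 k))
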